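{- For integers $m,k\ge 1$ let \[a(m, k) = |\mathrm{ParseWords}(\mathrm{LeftTurnTree}(m, k+1), \mathrm{RightTurnTree}(k, m+1))|.\] Then for all integers $m \geq 1$ and $k \geq 1$, \[a(m+3, k) - 2\, a(m+2, k) - a(m+1, k) + 2\, a(m, k) = 0.\]
   Context: A binary tree is a rooted ordered tree in which each vertex has either $0$ or $2$ children; its leaves are ordered left to right. Let $G$ be the context-free grammar with start symbols $0,1,2$ and rules $0\to 12$, $0\to 21$, $1\to 02$, $1\to 20$, $2\to 01$, $2\to 10$. An $n$-leaf binary tree $T$ parses a word $w$ of length $n$ on $\{0,1,2\}$ if there is a labeling of the vertices of $T$ by $0,1,2$ such that the leaves, from left to right, are labeled with the letters of $w$, and at every internal vertex the label of the vertex together with the labels of its left and right children form a rule of $G$ (i.e. the three labels are pairwise distinct). If $T$ parses $w$, it also parses every word obtained from $w$ by permuting the alphabet $\{0,1,2\}$. For binary trees $T_1,T_2$ with the same number of leaves, $\mathrm{ParseWords}(T_1,T_2)$ denotes the set of equivalence classes (under permutations of the alphabet $\{0,1,2\}$) of words parsed by both $T_1$ and $T_2$. The level of a vertex is its distance from the root. A path tree is a binary tree with at most two vertices on each level. For $N\ge 2$, $N$-leaf path trees correspond bijectively to words $x_1\cdots x_{N-2}$ on $\{l,r\}$: $x_j=l$ (resp. $x_j=r$) means that, of the two vertices on level $j$, the left (resp. right) one has children. $\mathrm{LeftTurnTree}(p,q)$ is the $(p+q)$-leaf path tree corresponding to $l^p r^{q-2}$, and $\mathrm{RightTurnTree}(p,q)$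 is the $(p+q)$-leaf path tree corresponding to $r^p l^{q-2}$. -}

module Defs where

open import Data.Empty using (⊥-elim)
open import Data.Fin.Base using (Fin; zero; suc; punchIn)
open import Data.Fin.Patterns using (0F; 1F; 2F)
open import Data.Fin.Permutation as Perm using (Permutation′; _⟨$⟩ʳ_)
open import Data.List.Base
  using (List; []; _∷_; [_]; _++_; map; replicate; length; lookup; deduplicate;
         cartesianProductWith; allFin)
open import Data.List.Membership.Propositional using (_∈_; lose; find)
open import Data.List.Membership.Propositional.Properties
  using (∈-map⁺; ∈-cartesianProductWith⁺; ∈-allFin; ∈-lookup)
open import Data.List.Properties using (≡-dec; map-cong; map-∘; map-id)
open import Data.List.Relation.Unary.All as All using (All)
open import Data.List.Relation.Unary.AllPairs using (AllPairs; _∷_)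
open import Data.List.Relation.Unary.Any as Any using (Any; here; there; any?; index)
open import Data.List.Relation.Unary.Any.Properties using (lookup-index)
open import Data.List.Relation.Unary.Enumerates.Setoid using (IsEnumeration)
open import Data.List.Relation.Unary.Enumerates.Setoid.Properties using (deduplicate⁺)
open import Data.List.Relation.Unary.Unique.DecSetoid.Properties using (deduplicate-!)
open import Data.Nat.Base using (ℕ; zero; suc; _+_; _∸_)
open import Data.Product.Base using (∃; _×_; _,_; proj₁; proj₂)
open import Data.Unit.Base using (⊤; tt)
open import Function.Base using (_∘_)
open import Function.Bundles using (Inverse)
open import Level using (0ℓ; Level)
open import Relation.Binary.Bundles using (Setoid; DecSetoid)
open import Relation.Binary.PropositionalEquality
  using (_≡_; refl; sym; trans; cong; subst; setoid)
open import Relation.Nullary using (¬_; Dec; yes; no)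
open import Relation.Nullary.Decidable using (map′; _×-dec_)

import Data.Fin.Properties as Fin

data Tree : Set where
  leaf : Tree
  node : Tree → Tree → Tree

Letter : Set
Letter = Fin 3

Word : Set
Word = List Letter

data Rule : Letter → Letter → Letter → Set where
  0→12 : Rule 0F 1F 2F
  0→21 : Rule 0F 2F 1F
  1→02 : Rule 1F 0F 2F
  1→20 : Rule 1F 2F 0F
  2→01 : Rule 2F 0F 1F
  2→10 : Rule 2F 1F 0F

data Labeling : Tree → Set where
  leaf : Letter → Labeling leaf
  node : ∀ {s t} → Letter → Labeling s → Labeling t → Labeling (node s t)

rootLabel : ∀ {t} → Labeling t → Letter
rootLabel (leaf a)     = a
rootLabel (node a _ _) = a

leafWord : ∀ {t} → Labeling t → Word
leafWord (leaf a)     = [ a ]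
leafWord (node _ l r) = leafWord l ++ leafWord r

Valid : ∀ {t} → Labeling t → Set
Valid (leaf _)     = ⊤
Valid (node a l r) = Rule a (rootLabel l) (rootLabel r) × Valid l × Valid r

-- The root may carry any letter: all of 0, 1, 2 are start symbols.
Parses : Tree → Word → Set
Parses t w = ∃ λ (l : Labeling t) → Valid l × leafWord l ≡ w

-- Equality of words up to a permutation of the alphabet.
_∼_ : Word → Word → Set
v ∼ w = ∃ λ (π : Permutation′ 3) → map (π ⟨$⟩ʳ_) v ≡ w

∼-refl : ∀ {w} → w ∼ w
∼-refl {w} = Perm.id , map-id w

∼-sym : ∀ {v w} → v ∼ w → w ∼ v
∼-sym {v} (π , refl) = Perm.flip π ,
  trans (sym (map-∘ v)) (trans (map-cong (λ _ → Perm.inverseˡ π) v) (map-id v))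

∼-trans : ∀ {u v w} → u ∼ v → v ∼ w → u ∼ w
∼-trans {u} (π , refl) (ρ , refl) = π Perm.∘ₚ ρ , map-∘ u

permutations : ∀ n → List (Permutation′ n)
permutations zero    = [ Perm.id ]
permutations (suc n) =
  cartesianProductWith (Perm.insert 0F) (allFin (suc n)) (permutations n)

insert-cong : ∀ {n} (j : Fin (suc n)) {π ρ : Permutation′ n} → π Perm.≈ ρ →
              Perm.insert 0F j π Perm.≈ Perm.insert 0F j ρ
insert-cong j π≈ρ zero    = refl
insert-cong j π≈ρ (suc i) = cong (punchIn j) (π≈ρ i)

permutations-complete : ∀ {n} (π : Permutation′ n) →
                        ∃ λ ρ → ρ ∈ permutations n × ρ Perm.≈ π
permutations-complete {zero}  π = Perm.id , here refl , λ ()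
permutations-complete {suc n} π
  with ρ , ρ∈ , ρ≈ ← permutations-complete (Perm.remove 0F π) =
  Perm.insert 0F (π ⟨$⟩ʳ 0F) ρ ,
  ∈-cartesianProductWith⁺ (Perm.insert 0F) (∈-allFin (π ⟨$⟩ʳ 0F)) ρ∈ ,
  λ i → trans (insert-cong (π ⟨$⟩ʳ 0F) {ρ} {Perm.remove 0F π} ρ≈ i)
              (Perm.insert-remove 0F π i)

∃-permutation? : ∀ {n} {P : Permutation′ n → Set} →
                 (∀ {π ρ} → π Perm.≈ ρ → P π → P ρ) →
                 (∀ π → Dec (P π)) → Dec (∃ P)
∃-permutation? {n} {P} resp P? = map′ to from (any? P? (permutations n))
  where
  to : Any P (permutations n) → ∃ P
  to p with π , _ , q ← find p = π , q

  from : ∃ P → Any P (permutations n)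
  from (π , q) with ρ , ρ∈ , ρ≈π ← permutations-complete π =
    lose ρ∈ (resp {π} {ρ} (sym ∘ ρ≈π) q)

_≟ʷ_ : (v w : Word) → Dec (v ≡ w)
_≟ʷ_ = ≡-dec Fin._≟_

_∼?_ : ∀ v w → Dec (v ∼ w)
v ∼? w = ∃-permutation? (λ π≈ρ → trans (sym (map-cong π≈ρ v)))
                        (λ π → map (π ⟨$⟩ʳ_) v ≟ʷ w)

rule? : ∀ a b c → Dec (Rule a b c)
rule? 0F 0F _  = no λ ()
rule? 0F 1F 0F = no λ ()
rule? 0F 1F 1F = no λ ()
rule? 0F 1F 2F = yes 0→12
rule? 0F 2F 0F = no λ ()
rule? 0F 2F 1F = yes 0→21
rule? 0F 2F 2F = no λ ()
rule? 1F 0F 0F = no λ ()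
rule? 1F 0F 1F = no λ ()
rule? 1F 0F 2F = yes 1→02
rule? 1F 1F _  = no λ ()
rule? 1F 2F 0F = yes 1→20
rule? 1F 2F 1F = no λ ()
rule? 1F 2F 2F = no λ ()
rule? 2F 0F 0F = no λ ()
rule? 2F 0F 1F = yes 2→01
rule? 2F 0F 2F = no λ ()
rule? 2F 1F 0F = yes 2→10
rule? 2F 1F 1F = no λ ()
rule? 2F 1F 2F = no λ ()
rule? 2F 2F _  = no λ ()

valid? : ∀ {t} (l : Labeling t) → Dec (Valid l)
valid? (leaf _)     = yes tt
valid? (node a l r) = rule? a (rootLabel l) (rootLabel r) ×-dec valid? l ×-dec valid? r

labelings : ∀ t → List (Labeling t)
labelings leaf       = map leaf (allFin 3)
labelings (node s t) =
  cartesianProductWith (λ a (l , r) → node a l r) (allFin 3)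
    (cartesianProductWith _,_ (labelings s) (labelings t))

labelings-complete : ∀ {t} (l : Labeling t) → l ∈ labelings t
labelings-complete (leaf a)     = ∈-map⁺ leaf (∈-allFin a)
labelings-complete (node a l r) =
  ∈-cartesianProductWith⁺ (λ a (l , r) → node a l r) (∈-allFin a)
    (∈-cartesianProductWith⁺ _,_ (labelings-complete l) (labelings-complete r))

parses? : ∀ t w → Dec (Parses t w)
parses? t w = map′ to (λ (l , p) → lose (labelings-complete l) p)
                   (any? (λ l → valid? l ×-dec leafWord l ≟ʷ w) (labelings t))
  where
  to : Any (λ l → Valid l × leafWord l ≡ w) (labelings t) → Parses t w
  to p with l , _ , q ← find p = l , q

private
  variable
    c p ℓ : Level

-- A setoid isomorphism with Fin n: S has exactly n equivalence classes.
HasSize : Setoid c ℓ → ℕ → Set _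
HasSize S n = Inverse S (setoid (Fin n))

module _ (D : DecSetoid c ℓ) where
  open DecSetoid D renaming (setoid to S) hiding (refl)

  lookup-injective : ∀ {xs} → AllPairs (λ x y → ¬ (x ≈ y)) xs →
                     ∀ i j → lookup xs i ≈ lookup xs j → i ≡ j
  lookup-injective (_ ∷ _)       zero    zero    _  = refl
  lookup-injective {_ ∷ xs} (x∉ ∷ _) zero (suc j) eq =
    ⊥-elim (All.lookup x∉ (∈-lookup {xs = xs} j) eq)
  lookup-injective {_ ∷ xs} (x∉ ∷ _) (suc i) zero eq =
    ⊥-elim (All.lookup x∉ (∈-lookup {xs = xs} i) (DecSetoid.sym D eq))
  lookup-injective (_ ∷ xs!)     (suc i) (suc j) eq =
    cong suc (lookup-injective xs! i j eq)

  enumerable⇒finite : ∀ {xs} → IsEnumeration S xs → ∃ (HasSize S)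
  enumerable⇒finite {xs} enum = length ys , record
    { to        = to
    ; from      = lookup ys
    ; to-cong   = λ {x} {y} x≈y → lookup-injective ys! (to x) (to y)
        (S.trans (S.sym (spec x)) (S.trans x≈y (spec y)))
    ; from-cong = λ where refl → S.refl
    ; inverse   =
        (λ {i} {x} x≈ → lookup-injective ys! (to x) i (S.trans (S.sym (spec x)) x≈)) ,
        (λ where refl → S.sym (spec _))
    }
    where
    module S = DecSetoid D
    ys  = deduplicate _≟_ xs
    ys! = deduplicate-! D xs
    ys∋ = deduplicate⁺ D enum

    to : S.Carrier → Fin (length ys)
    to x = index (ys∋ x)

    spec : ∀ x → x ≈ lookup ys (to x)
    spec x = lookup-index (ys∋ x)

module _ {A : Set c} {P : A → Set p} (P? : ∀ x → Dec (P x)) where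

  withProofs : List A → List (∃ P)
  withProofs []       = []
  withProofs (x ∷ xs) with P? x
  ... | yes px = (x , px) ∷ withProofs xs
  ... | no  _  = withProofs xs

  ∈-withProofs : ∀ {x xs} → P x → x ∈ xs → Any (λ y → x ≡ proj₁ y) (withProofs xs)
  ∈-withProofs {xs = y ∷ xs} px x∈ with P? y | x∈
  ... | yes _  | here eq   = here eq
  ... | yes _  | there x∈′ = there (∈-withProofs px x∈′)
  ... | no ¬py | here eq   = ⊥-elim (¬py (subst P eq px))
  ... | no _   | there x∈′ = ∈-withProofs px x∈′

-- The set of equivalence classes is the setoid of words parsed by both
-- trees, compared by _∼_ on the words alone.
ParseWords-decSetoid : Tree → Tree → DecSetoid 0ℓ 0ℓ
ParseWords-decSetoid t₁ t₂ = record
  { Carrier = ∃ λ w → Parses t₁ w × Parses t₂ w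
  ; _≈_     = λ x y → proj₁ x ∼ proj₁ y
  ; isDecEquivalence = record
    { isEquivalence = record { refl = ∼-refl ; sym = ∼-sym ; trans = ∼-trans }
    ; _≟_ = λ x y → proj₁ x ∼? proj₁ y
    }
  }

ParseWords : Tree → Tree → Setoid 0ℓ 0ℓ
ParseWords t₁ t₂ = DecSetoid.setoid (ParseWords-decSetoid t₁ t₂)

-- Only the fact that the number has the property HasSize matters, not the
-- enumeration by which it is found.
opaque
  ParseWords-finite : ∀ t₁ t₂ → ∃ (HasSize (ParseWords t₁ t₂))
  ParseWords-finite t₁ t₂ =
    enumerable⇒finite (ParseWords-decSetoid t₁ t₂) {withProofs both? candidates} complete
    where
    both? : ∀ w → Dec (Parses t₁ w × Parses t₂ w)
    both? w = parses? t₁ w ×-dec parses? t₂ w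

    candidates : List Word
    candidates = map leafWord (labelings t₁)

    complete : IsEnumeration (ParseWords t₁ t₂) (withProofs both? candidates)
    complete (w , ps@((l , _ , refl) , _)) =
      Any.map (λ where refl → ∼-refl)
        (∈-withProofs both? ps (∈-map⁺ leafWord (labelings-complete l)))

∣ParseWords∣ : Tree → Tree → ℕ
∣ParseWords∣ t₁ t₂ = proj₁ (ParseWords-finite t₁ t₂)

data Direction : Set where
  left right : Direction

-- The head of the word says which of the two vertices on level 1 has
-- children; the tail describes the subtree rooted there.  A word of
-- length N ∸ 2 gives an N-leaf tree.
pathTree : List Direction → Tree
pathTree []           = node leaf leaf
pathTree (left  ∷ xs) = node (pathTree xs) leaf
pathTree (right ∷ xs) = node leaf (pathTree xs)

-- Meaningful for q ≥ 2, where the truncated subtraction is exact.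
LeftTurnTree : ℕ → ℕ → Tree
LeftTurnTree p q = pathTree (replicate p left ++ replicate (q ∸ 2) right)

RightTurnTree : ℕ → ℕ → Tree
RightTurnTree p q = pathTree (replicate p right ++ replicate (q ∸ 2) left)

a : ℕ → ℕ → ℕ
a m k = ∣ParseWords∣ (LeftTurnTree m (k + 1)) (RightTurnTree k (m + 1))

{-# OPTIONS --safe #-}
-- Write a word as x₁ … x_k c y₁ … y_m.  The first tree folds c into the x's
-- from the right and then the y's into the result from the left; the second
-- tree folds the y's first.  Permuting the alphabet acts freely on these words,
-- and each orbit has exactly one member with c = 0 and y₁ = 1, so a m k counts
-- such words.  Fix the x's.  Reading the y's moves the pair (p , q) of the
-- labels reached in the two trees: if p ≢ q, the next letter must be the third
-- one, and it swaps p and q; if p ≡ q, there are two choices, leading to the two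
-- other pairs of equal labels.  A swap has eigenvalues ± 1 and the adjacency
-- matrix of a triangle has eigenvalues 2 , -1 , -1, so every count of such walks
-- is annihilated by (E - 2)(E - 1)(E + 1) = E³ - 2 E² - E + 2, with E the shift n ↦ n + 1.
module Submission where

open import Defs
open import Data.Bool.Base using (Bool; T; _∧_; if_then_else_)
open import Data.Bool.Properties using (∧-zeroʳ; T-∧; T?)
open import Data.Empty using (⊥-elim)
open import Data.Fin.Base using (Fin)
open import Data.Fin.Patterns using (0F; 1F; 2F)
open import Data.Fin.Permutation using (Permutation′; _⟨$⟩ʳ_; ↔⇒≡)
open import Data.Fin.Properties using (_≟_; all?)
open import Data.List.Base
  using (List; []; _∷_; [_]; _++_; _∷ʳ_; map; replicate; length; lookup;
         cartesianProductWith; allFin)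
open import Data.List.Membership.Propositional using (_∈_)
open import Data.List.Membership.Propositional.Properties
  using (∈-cartesianProductWith⁺; ∈-allFin)
open import Data.List.Properties
  using (++-assoc; ++-identityʳ; ∷-injectiveˡ; ∷-injectiveʳ;
         map-++; map-cong; map-∘)
open import Data.List.Relation.Unary.All using (All; []; _∷_)
open import Data.List.Relation.Unary.AllPairs using (AllPairs; []; _∷_)
open import Data.List.Relation.Unary.Any as Any using (here; index)
open import Data.List.Relation.Unary.Any.Properties using (lookup-index)
open import Data.List.Relation.Unary.Enumerates.Setoid using (IsEnumeration)
open import Data.List.Relation.Unary.Unique.Propositional using (Unique)
open import Data.List.Relation.Unary.Unique.Propositional.Properties using (allFin⁺)
open import Data.List.Relation.Unary.Unique.Setoid.Properties using (cartesianProductWith⁺)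
open import Data.Maybe.Base using (Maybe; just; nothing; is-just; _>>=_)
open import Data.Nat.Base as ℕ using (ℕ; _≥_)
open import Data.Nat.ListAction using (sum)
open import Data.Nat.ListAction.Properties using (sum-++)
open import Data.Nat.Properties using (+-comm; +-identityʳ; +-cancelˡ-≡; m+n∸n≡m)
open import Data.Nat.Solver using (module +-*-Solver)
open import Data.Integer.Base using (+_; _+_; _-_; _*_; 0ℤ)
open import Data.Integer.Properties using (i≡j⇒i-j≡0; pos-*)
open import Data.Product.Base using (∃; _×_; _,_; proj₁; proj₂)
open import Data.Unit.Base using (tt)
open import Data.Vec.Base as Vec using (Vec; []; _∷_; toList)
open import Data.Vec.Properties as Vec using (toList-map)
open import Function.Base using (_∘_)
open import Function.Bundles using (_⇔_; mk⇔; Equivalence)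
open import Function.Construct.Composition using () renaming (inverse to infixr 9 _⊙_)
open import Function.Construct.Symmetry using () renaming (inverse to flipInverse)
open import Level using (Level)
open import Relation.Binary.Bundles using (Setoid; DecSetoid)
open import Relation.Binary.PropositionalEquality
  using (_≡_; _≢_; refl; sym; trans; cong; cong₂; subst; setoid; module ≡-Reasoning)
open import Relation.Nullary using (¬_; Dec; yes; no; does)
open import Relation.Nullary.Decidable using (does-⇔; from-yes; ¬?; _→-dec_; _×-dec_)

import Data.Integer.Solver as ℤ
import Data.Fin.Permutation as Perm

private
  variable
    ℓ₁ ℓ₂ p r : Level
    A B C : Set ℓ₁
    m n : ℕ
    b c d : Letter
    s t : Tree
    u v w : Word

-- Counting the classes of a setoid.

module _ (D : DecSetoid ℓ₁ ℓ₂) where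
  open DecSetoid D renaming (setoid to S) hiding (refl)

  HasSize-length : ∀ {xs} → AllPairs (λ x y → ¬ (x ≈ y)) xs → IsEnumeration S xs →
                   HasSize S (length xs)
  HasSize-length {xs} xs! enum = record
    { to        = to
    ; from      = lookup xs
    ; to-cong   = λ {x} {y} x≈y → lookup-injective D xs! (to x) (to y)
        (S.trans (S.sym (spec x)) (S.trans x≈y (spec y)))
    ; from-cong = λ where refl → S.refl
    ; inverse   =
        (λ {i} {x} x≈ → lookup-injective D xs! (to x) i (S.trans (S.sym (spec x)) x≈)) ,
        (λ where refl → S.sym (spec _))
    }
    where
    module S = DecSetoid D

    to : S.Carrier → Fin (length xs)
    to x = index (enum x)

    spec : ∀ x → x ≈ lookup xs (to x)
    spec x = lookup-index (enum x)

-- Composing the two isomorphisms through `S` gives a bijection between `Fin m` and `Fin n`. Since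
-- `ParseWords-finite` is opaque, this is how `∣ParseWords∣` gets evaluated: by comparison with
-- another enumeration free of repetitions.
HasSize-unique : {S : Setoid ℓ₁ ℓ₂} → HasSize S m → HasSize S n → m ≡ n
HasSize-unique f g = ↔⇒≡ (flipInverse f ⊙ g)

-- Finite sums and filtered lists.

⟦_⟧ : Bool → ℕ
⟦ x ⟧ = if x then 1 else 0

∑ : List A → (A → ℕ) → ℕ
∑ xs f = sum (map f xs)

∑-cong : ∀ {f g : A → ℕ} xs → (∀ x → f x ≡ g x) → ∑ xs f ≡ ∑ xs g
∑-cong xs f≗g = cong sum (map-cong f≗g xs)

∑-zero : ∀ (xs : List A) {f : A → ℕ} → (∀ x → f x ≡ 0) → ∑ xs f ≡ 0
∑-zero []       f≗0 = refl
∑-zero (x ∷ xs) f≗0 = cong₂ ℕ._+_ (f≗0 x) (∑-zero xs f≗0)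

∑-cartesianProductWith : ∀ (g : A → B → C) xs ys (f : C → ℕ) →
  ∑ (cartesianProductWith g xs ys) f ≡ ∑ xs λ x → ∑ ys λ y → f (g x y)
∑-cartesianProductWith g []       ys f = refl
∑-cartesianProductWith g (x ∷ xs) ys f = begin
  sum (map f (map (g x) ys ++ zs))           ≡⟨ cong sum (map-++ f (map (g x) ys) zs) ⟩
  sum (map f (map (g x) ys) ++ map f zs)     ≡⟨ sum-++ (map f (map (g x) ys)) _ ⟩
  sum (map f (map (g x) ys)) ℕ.+ ∑ zs f
    ≡⟨ cong₂ ℕ._+_ (cong sum (sym (map-∘ ys))) (∑-cartesianProductWith g xs ys f) ⟩
  (∑ ys λ y → f (g x y)) ℕ.+ (∑ xs λ x → ∑ ys λ y → f (g x y)) ∎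
  where
  open ≡-Reasoning
  zs = cartesianProductWith g xs ys

module _ {P : A → Set p} (P? : ∀ x → Dec (P x)) where

  length-withProofs : ∀ xs → length (withProofs P? xs) ≡ ∑ xs λ x → ⟦ does (P? x) ⟧
  length-withProofs []       = refl
  length-withProofs (x ∷ xs) with P? x
  ... | yes _ = cong ℕ.suc (length-withProofs xs)
  ... | no  _ = length-withProofs xs

  All-withProofs : ∀ {Q : A → Set r} {xs} → All Q xs → All (Q ∘ proj₁) (withProofs P? xs)
  All-withProofs []                = []
  All-withProofs {xs = x ∷ _} (q ∷ qs) with P? x
  ... | yes _ = q ∷ All-withProofs qs
  ... | no  _ = All-withProofs qs

  AllPairs-withProofs : ∀ {R : A → A → Set r} {xs} → AllPairs R xs →
                        AllPairs (λ x y → R (proj₁ x) (proj₁ y)) (withProofs P? xs)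
  AllPairs-withProofs []                = []
  AllPairs-withProofs {xs = x ∷ _} (q ∷ qs) with P? x
  ... | yes _ = All-withProofs q ∷ AllPairs-withProofs qs
  ... | no  _ = AllPairs-withProofs qs

-- Partial values and vectors.

>>=-just : ∀ (x : Maybe A) {f : A → Maybe B} {z} → (x >>= f) ≡ just z →
           ∃ λ y → x ≡ just y × f y ≡ just z
>>=-just (just y) eq = y , refl , eq

just->>= : ∀ {x : Maybe A} {y} {f : A → Maybe B} {z} → x ≡ just y → f y ≡ just z →
           (x >>= f) ≡ just z
just->>= refl eq = eq

T-is-just : ∀ {x : Maybe A} → (∃ λ y → x ≡ just y) ⇔ T (is-just x)
T-is-just {x = x} = mk⇔ (λ where (_ , refl) → tt) (from x)
  where
  from : ∀ x → T (is-just x) → ∃ λ y → x ≡ just y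
  from (just y) _ = y , refl

toList-++-injective : ∀ (xs ys : Vec A n) {us vs} → toList xs ++ us ≡ toList ys ++ vs →
                      xs ≡ ys × us ≡ vs
toList-++-injective []       []       eq = refl , eq
toList-++-injective (x ∷ xs) (y ∷ ys) eq
  with xs≡ys , us≡vs ← toList-++-injective xs ys (∷-injectiveʳ eq) =
  cong₂ _∷_ (∷-injectiveˡ eq) xs≡ys , us≡vs

toList-injective : ∀ (xs ys : Vec A n) → toList xs ≡ toList ys → xs ≡ ys
toList-injective []       []       _  = refl
toList-injective (x ∷ xs) (y ∷ ys) eq =
  cong₂ _∷_ (∷-injectiveˡ eq) (toList-injective xs ys (∷-injectiveʳ eq))

-- Derivations and permutations of the alphabet.

data Derives : Tree → Word → Letter → Set where
  leaf : Derives leaf [ b ] b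
  node : Rule b c d → Derives s u c → Derives t v d → Derives (node s t) (u ++ v) b

-- `Derives` carries the word and the root label as indices, so parsing can be inverted by pattern
-- matching instead of through a labeling with a separate validity proof and word equation.
Parses⇒Derives : Parses t w → ∃ (Derives t w)
Parses⇒Derives (l , l✓ , refl) = rootLabel l , go l l✓
  where
  go : (l : Labeling t) → Valid l → Derives t (leafWord l) (rootLabel l)
  go (leaf _)     _                = leaf
  go (node _ l r) (rule , l✓ , r✓) = node rule (go l l✓) (go r r✓)

Derives⇒labeling : Derives t w b →
                   ∃ λ (l : Labeling t) → Valid l × leafWord l ≡ w × rootLabel l ≡ b
Derives⇒labeling (leaf {b}) = leaf b , tt , refl , refl
Derives⇒labeling (node {b} rule δ ε)
  with l , l✓ , refl , refl ← Derives⇒labeling δ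
     | r , r✓ , refl , refl ← Derives⇒labeling ε =
  node b l r , (rule , l✓ , r✓) , refl , refl

Derives⇒Parses : Derives t w b → Parses t w
Derives⇒Parses δ with l , l✓ , eq , _ ← Derives⇒labeling δ = l , l✓ , eq

Rule⇒distinct : Rule b c d → b ≢ c × b ≢ d × c ≢ d
Rule⇒distinct 0→12 = (λ ()) , (λ ()) , λ ()
Rule⇒distinct 0→21 = (λ ()) , (λ ()) , λ ()
Rule⇒distinct 1→02 = (λ ()) , (λ ()) , λ ()
Rule⇒distinct 1→20 = (λ ()) , (λ ()) , λ ()
Rule⇒distinct 2→01 = (λ ()) , (λ ()) , λ ()
Rule⇒distinct 2→10 = (λ ()) , (λ ()) , λ ()

distinct⇒Rule : ∀ b c d → b ≢ c × b ≢ d × c ≢ d → Rule b c d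
distinct⇒Rule = from-yes (all? λ b → all? λ c → all? λ d →
  (¬? (b ≟ c) ×-dec ¬? (b ≟ d) ×-dec ¬? (c ≟ d)) →-dec rule? b c d)

⟨$⟩ʳ-injective : ∀ (π : Permutation′ n) {i j} → π ⟨$⟩ʳ i ≡ π ⟨$⟩ʳ j → i ≡ j
⟨$⟩ʳ-injective π eq =
  trans (sym (Perm.inverseˡ π)) (trans (cong (π Perm.⟨$⟩ˡ_) eq) (Perm.inverseˡ π))

-- Three letters form a rule exactly when they are pairwise distinct, and an injective relabeling
-- keeps them so.
Derives-permute : ∀ (π : Permutation′ 3) → Derives t w b →
                  Derives t (map (π ⟨$⟩ʳ_) w) (π ⟨$⟩ʳ b)
Derives-permute π leaf = leaf
Derives-permute π (node {u = u} {v = v} rule δ ε)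
  with b≢c , b≢d , c≢d ← Rule⇒distinct rule =
  subst (λ w → Derives _ w _) (sym (map-++ (π ⟨$⟩ʳ_) u v))
    (node (distinct⇒Rule _ _ _
            (b≢c ∘ ⟨$⟩ʳ-injective π , b≢d ∘ ⟨$⟩ʳ-injective π , c≢d ∘ ⟨$⟩ʳ-injective π))
          (Derives-permute π δ) (Derives-permute π ε))

Parses-resp-∼ : v ∼ w → Parses t v → Parses t w
Parses-resp-∼ (π , refl) = Derives⇒Parses ∘ Derives-permute π ∘ proj₂ ∘ Parses⇒Derives

-- Parsing as evaluation of a partial product.

infixl 7 _·_

-- In every rule the children determine the parent. Hence a word has at most one root label in a
-- given tree, and parsing succeeds exactly when all products are defined.
_·_ : Letter → Letter → Maybe Letter
0F · 0F = nothing
0F · 1F = just 2F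
0F · 2F = just 1F
1F · 0F = just 2F
1F · 1F = nothing
1F · 2F = just 0F
2F · 0F = just 1F
2F · 1F = just 0F
2F · 2F = nothing

Rule⇒· : Rule b c d → c · d ≡ just b
Rule⇒· 0→12 = refl
Rule⇒· 0→21 = refl
Rule⇒· 1→02 = refl
Rule⇒· 1→20 = refl
Rule⇒· 2→01 = refl
Rule⇒· 2→10 = refl

·⇒Rule : ∀ c d → c · d ≡ just b → Rule b c d
·⇒Rule 0F 1F refl = 2→01
·⇒Rule 0F 2F refl = 1→02
·⇒Rule 1F 0F refl = 2→10
·⇒Rule 1F 2F refl = 0→12
·⇒Rule 2F 0F refl = 1→20
·⇒Rule 2F 1F refl = 0→21
·⇒Rule 2F 2F ()

foldL : Letter → Vec Letter n → Maybe Letter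
foldL c []       = just c
foldL c (y ∷ ys) = c · y >>= λ d → foldL d ys

foldR : Vec Letter n → Letter → Maybe Letter
foldR []       c = just c
foldR (x ∷ xs) c = foldR xs c >>= (x ·_)

-- Path trees as nested spines.

leftSpine : ℕ → Tree → Tree
leftSpine ℕ.zero    t = t
leftSpine (ℕ.suc n) t = leftSpine n (node t leaf)

rightSpine : ℕ → Tree → Tree
rightSpine ℕ.zero    t = t
rightSpine (ℕ.suc n) t = node leaf (rightSpine n t)

-- `leftSpine` wraps `t` from the inside out, the order in which `foldL` reads its letters, whereas
-- `pathTree` builds from the root. This lemma passes between the two.
leftSpine-node : ∀ n t → leftSpine n (node t leaf) ≡ node (leftSpine n t) leaf
leftSpine-node ℕ.zero    t = refl
leftSpine-node (ℕ.suc n) t = leftSpine-node n (node t leaf)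

pathTree-left : ∀ n ds → pathTree (replicate n left ++ ds) ≡ leftSpine n (pathTree ds)
pathTree-left ℕ.zero    ds = refl
pathTree-left (ℕ.suc n) ds =
  trans (cong (λ t → node t leaf) (pathTree-left n ds)) (sym (leftSpine-node n _))

pathTree-right : ∀ n ds → pathTree (replicate n right ++ ds) ≡ rightSpine n (pathTree ds)
pathTree-right ℕ.zero    ds = refl
pathTree-right (ℕ.suc n) ds = cong (node leaf) (pathTree-right n ds)

-- The bottom `node leaf leaf` of a path tree counts as one more spine vertex over a `leaf`, whence
-- the `suc`.
pathTree-replicate-left : ∀ n → pathTree (replicate n left) ≡ leftSpine (ℕ.suc n) leaf
pathTree-replicate-left n =
  trans (cong pathTree (sym (++-identityʳ (replicate n left)))) (pathTree-left n [])

pathTree-replicate-right : ∀ n → pathTree (replicate n right) ≡ rightSpine (ℕ.suc n) leaf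
pathTree-replicate-right ℕ.zero    = refl
pathTree-replicate-right (ℕ.suc n) = cong (node leaf) (pathTree-replicate-right n)

-- The purpose of this lemma and the next is to show that, for positive parameters, the two trees of
-- `a` are the same two spines nested in opposite orders.
LeftTurnTree-spine : ∀ m k → LeftTurnTree m (ℕ.suc k ℕ.+ 1) ≡
                             leftSpine m (rightSpine (ℕ.suc k) leaf)
LeftTurnTree-spine m k rewrite m+n∸n≡m k 1 =
  trans (pathTree-left m _) (cong (leftSpine m) (pathTree-replicate-right k))

RightTurnTree-spine : ∀ k m → RightTurnTree k (ℕ.suc m ℕ.+ 1) ≡
                              rightSpine k (leftSpine (ℕ.suc m) leaf)
RightTurnTree-spine k m rewrite m+n∸n≡m m 1 =
  trans (pathTree-right k _) (cong (rightSpine k) (pathTree-replicate-left m))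

-- Derivations along a spine.

Derives-node-leaf⁻ : Derives (node t leaf) w b →
  ∃ λ u → ∃ λ c → ∃ λ y → w ≡ u ∷ʳ y × Rule b c y × Derives t u c
Derives-node-leaf⁻ (node rule δ leaf) = _ , _ , _ , refl , rule , δ

Derives-leaf-node⁻ : Derives (node leaf t) w b →
  ∃ λ x → ∃ λ u → ∃ λ c → w ≡ x ∷ u × Rule b x c × Derives t u c
Derives-leaf-node⁻ (node rule leaf δ) = _ , _ , _ , refl , rule , δ

Derives-leftSpine⁺ : ∀ (ys : Vec Letter n) → Derives t u c → foldL c ys ≡ just b →
                     Derives (leftSpine n t) (u ++ toList ys) b
Derives-leftSpine⁺ {u = u} [] δ refl =
  subst (λ w → Derives _ w _) (sym (++-identityʳ u)) δ
Derives-leftSpine⁺ {u = u} {c = c} (y ∷ ys) δ eq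
  with d , eq₁ , eq₂ ← >>=-just (c · y) eq =
  subst (λ w → Derives _ w _) (++-assoc u [ y ] (toList ys))
    (Derives-leftSpine⁺ ys (node (·⇒Rule c y eq₁) δ leaf) eq₂)

-- The induction generalizes over `t`: the hypothesis is applied to `node t leaf`, and splitting the
-- derivation of that node yields the first letter of `ys`.
Derives-leftSpine⁻ : ∀ n → Derives (leftSpine n t) w b →
  ∃ λ u → ∃ λ (ys : Vec Letter n) → ∃ λ c →
    w ≡ u ++ toList ys × Derives t u c × foldL c ys ≡ just b
Derives-leftSpine⁻ {w = w} ℕ.zero δ = w , [] , _ , sym (++-identityʳ w) , δ , refl
Derives-leftSpine⁻ (ℕ.suc n) δ
  with _ , ys , _ , refl , ε , eq ← Derives-leftSpine⁻ n δ
  with u , c , y , refl , rule , δ′ ← Derives-node-leaf⁻ ε =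
  u , y ∷ ys , c , ++-assoc u [ y ] (toList ys) , δ′ , just->>= (Rule⇒· rule) eq

Derives-rightSpine⁺ : ∀ (xs : Vec Letter n) → Derives t u c → foldR xs c ≡ just b →
                      Derives (rightSpine n t) (toList xs ++ u) b
Derives-rightSpine⁺ []       δ refl = δ
Derives-rightSpine⁺ {c = c} (x ∷ xs) δ eq
  with d , eq₁ , eq₂ ← >>=-just (foldR xs c) eq =
  node (·⇒Rule x d eq₂) leaf (Derives-rightSpine⁺ xs δ eq₁)

Derives-rightSpine⁻ : ∀ n → Derives (rightSpine n t) w b →
  ∃ λ (xs : Vec Letter n) → ∃ λ u → ∃ λ c →
    w ≡ toList xs ++ u × Derives t u c × foldR xs c ≡ just b
Derives-rightSpine⁻ ℕ.zero δ = [] , _ , _ , refl , δ , refl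
Derives-rightSpine⁻ (ℕ.suc n) δ
  with x , _ , _ , refl , rule , ε ← Derives-leaf-node⁻ δ
  with xs , u , c , refl , δ′ , eq ← Derives-rightSpine⁻ n ε =
  x ∷ xs , u , c , refl , δ′ , just->>= eq (Rule⇒· rule)

-- Words parsed by both trees.

arch : Vec Letter m → Letter → Vec Letter n → Word
arch xs c ys = toList xs ++ c ∷ toList ys

arch-injective : ∀ (xs xs′ : Vec Letter m) (ys ys′ : Vec Letter n) →
                 arch xs c ys ≡ arch xs′ d ys′ → xs ≡ xs′ × c ≡ d × ys ≡ ys′
arch-injective xs xs′ ys ys′ eq
  with xs≡xs′ , eq′ ← toList-++-injective xs xs′ eq =
  xs≡xs′ , ∷-injectiveˡ eq′ , toList-injective ys ys′ (∷-injectiveʳ eq′)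

-- The names give the order of folding, which runs from the bottom of the tree: `foldRL` belongs to
-- a left spine above a right spine, and `foldLR` to the reverse.
foldRL : Vec Letter m → Letter → Vec Letter n → Maybe Letter
foldRL xs c ys = foldR xs c >>= λ d → foldL d ys

foldLR : Vec Letter m → Letter → Vec Letter n → Maybe Letter
foldLR xs c ys = foldL c ys >>= foldR xs

-- Inversion yields some decomposition of the word. As the spine lengths fix where the word is cut,
-- `arch-injective` identifies it with the given one.
Derives-leftSpine-rightSpine : ∀ (xs : Vec Letter m) (ys : Vec Letter n) →
  Derives (leftSpine n (rightSpine m leaf)) (arch xs c ys) b ⇔ foldRL xs c ys ≡ just b
Derives-leftSpine-rightSpine {m} {n} {c} {b} xs ys = mk⇔ to from
  where
  to : Derives (leftSpine n (rightSpine m leaf)) (arch xs c ys) b → foldRL xs c ys ≡ just b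
  to δ
    with _ , ys′ , _ , eq , δ′ , eq₁ ← Derives-leftSpine⁻ n δ
    with xs′ , _ , d , refl , leaf , eq₂ ← Derives-rightSpine⁻ m δ′
    with refl , refl , refl ← arch-injective xs xs′ ys ys′
      (trans eq (++-assoc (toList xs′) [ d ] (toList ys′))) =
    just->>= eq₂ eq₁

  from : foldRL xs c ys ≡ just b → Derives (leftSpine n (rightSpine m leaf)) (arch xs c ys) b
  from eq with _ , eq₁ , eq₂ ← >>=-just (foldR xs c) eq =
    subst (λ w → Derives _ w _) (++-assoc (toList xs) [ c ] (toList ys))
      (Derives-leftSpine⁺ ys (Derives-rightSpine⁺ xs leaf eq₁) eq₂)

Derives-rightSpine-leftSpine⁻ : ∀ m n → Derives (rightSpine m (leftSpine n leaf)) w b →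
  ∃ λ (xs : Vec Letter m) → ∃ λ c → ∃ λ (ys : Vec Letter n) →
    w ≡ arch xs c ys × foldLR xs c ys ≡ just b
Derives-rightSpine-leftSpine⁻ m n δ
  with xs , _ , _ , refl , δ′ , eq₁ ← Derives-rightSpine⁻ m δ
  with _ , ys , c , refl , leaf , eq₂ ← Derives-leftSpine⁻ n δ′ =
  xs , c , ys , refl , just->>= eq₂ eq₁

Derives-rightSpine-leftSpine : ∀ (xs : Vec Letter m) (ys : Vec Letter n) →
  Derives (rightSpine m (leftSpine n leaf)) (arch xs c ys) b ⇔ foldLR xs c ys ≡ just b
Derives-rightSpine-leftSpine {m} {n} {c} {b} xs ys = mk⇔ to from
  where
  to : Derives (rightSpine m (leftSpine n leaf)) (arch xs c ys) b → foldLR xs c ys ≡ just b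
  to δ
    with xs′ , _ , ys′ , eq , eq₁ ← Derives-rightSpine-leftSpine⁻ m n δ
    with refl , refl , refl ← arch-injective xs xs′ ys ys′ eq = eq₁

  from : foldLR xs c ys ≡ just b → Derives (rightSpine m (leftSpine n leaf)) (arch xs c ys) b
  from eq with _ , eq₁ , eq₂ ← >>=-just (foldL c ys) eq =
    Derives-rightSpine⁺ xs (Derives-leftSpine⁺ ys leaf eq₁) eq₂

-- A boolean, so that it can be summed through `⟦_⟧`. It tests only that each tree has a root label.
parsedByBoth : Vec Letter m → Letter → Vec Letter n → Bool
parsedByBoth xs c ys = is-just (foldRL xs c ys) ∧ is-just (foldLR xs c ys)

parsedByBoth-correct : ∀ (xs : Vec Letter m) c (ys : Vec Letter n) →
  (Parses (leftSpine n (rightSpine m leaf)) (arch xs c ys) ×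
   Parses (rightSpine m (leftSpine n leaf)) (arch xs c ys)) ⇔ T (parsedByBoth xs c ys)
parsedByBoth-correct xs c ys = mk⇔ to from
  where
  open Equivalence using () renaming (to to ⇒; from to ⇐)
  RL = λ {b} → Derives-leftSpine-rightSpine {c = c} {b = b} xs ys
  LR = λ {b} → Derives-rightSpine-leftSpine {c = c} {b = b} xs ys

  to : _ → _
  to (p₁ , p₂) with _ , δ₁ ← Parses⇒Derives p₁ | _ , δ₂ ← Parses⇒Derives p₂ =
    ⇐ T-∧ (⇒ T-is-just (_ , ⇒ RL δ₁) , ⇒ T-is-just (_ , ⇒ LR δ₂))

  from : _ → _
  from h with h₁ , h₂ ← ⇒ T-∧ h
    with _ , eq₁ ← ⇐ T-is-just h₁ | _ , eq₂ ← ⇐ T-is-just h₂ =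
    Derives⇒Parses (⇐ RL eq₁) , Derives⇒Parses (⇐ LR eq₂)

-- Representatives of the orbits.

words : ∀ n → List (Vec Letter n)
words ℕ.zero    = [ [] ]
words (ℕ.suc n) = cartesianProductWith _∷_ (allFin 3) (words n)

∈-words : ∀ (xs : Vec Letter n) → xs ∈ words n
∈-words []       = here refl
∈-words (x ∷ xs) = ∈-cartesianProductWith⁺ _∷_ (∈-allFin x) (∈-words xs)

words-! : ∀ n → Unique (words n)
words-! ℕ.zero    = [] ∷ []
words-! (ℕ.suc n) = cartesianProductWith⁺ (setoid _) (setoid _) (setoid _)
  _∷_ Vec.∷-injective (allFin⁺ 3) (words-! n)

∼-setoid : Setoid _ _
∼-setoid = record
  { Carrier = Word ; _≈_ = _∼_
  ; isEquivalence = record { refl = ∼-refl ; sym = ∼-sym ; trans = ∼-trans } }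

map-arch : ∀ (f : Letter → Letter) (xs : Vec Letter m) c (ys : Vec Letter n) →
           map f (arch xs c ys) ≡ arch (Vec.map f xs) (f c) (Vec.map f ys)
map-arch f xs c ys = trans (map-++ f (toList xs) (c ∷ toList ys))
  (cong₂ (λ us vs → us ++ f c ∷ vs) (sym (toList-map f xs)) (sym (toList-map f ys)))

normalForm : Vec Letter m → Vec Letter n → Word
normalForm xs ys = arch xs 0F (1F ∷ ys)

-- By injectivity, 2 is the only image left for 2. This makes the normal form of an orbit unique.
fix-01⇒id : ∀ (π : Permutation′ 3) → π ⟨$⟩ʳ 0F ≡ 0F → π ⟨$⟩ʳ 1F ≡ 1F → ∀ i → π ⟨$⟩ʳ i ≡ i
fix-01⇒id π eq₀ eq₁ 0F = eq₀
fix-01⇒id π eq₀ eq₁ 1F = eq₁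
fix-01⇒id π eq₀ eq₁ 2F with π ⟨$⟩ʳ 2F in eq₂
... | 0F with () ← ⟨$⟩ʳ-injective π (trans eq₀ (sym eq₂))
... | 1F with () ← ⟨$⟩ʳ-injective π (trans eq₁ (sym eq₂))
... | 2F = refl

normalForm-injective : ∀ {xs xs′ : Vec Letter m} {ys ys′ : Vec Letter n} →
                       normalForm xs ys ∼ normalForm xs′ ys′ → xs ≡ xs′ × ys ≡ ys′
normalForm-injective {xs = xs} {xs′} {ys} {ys′} (π , eq)
  with refl , eq₀ , eq₁ ← arch-injective (Vec.map (π ⟨$⟩ʳ_) xs) xs′ _ (1F ∷ ys′)
         (trans (sym (map-arch (π ⟨$⟩ʳ_) xs 0F (1F ∷ ys))) eq)
  with eq₁ , refl ← Vec.∷-injective eq₁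
  -- `eq₀` comes from the centre letter and `eq₁` from the letter after it, the two letters on which
  -- all normal forms agree.
  with π≗id ← fix-01⇒id π eq₀ eq₁ =
  sym (trans (Vec.map-cong π≗id xs) (Vec.map-id xs)) ,
  sym (trans (Vec.map-cong π≗id ys) (Vec.map-id ys))

-- Opaque because the decided proof is too large to unfold.
opaque
  normalize₂ : ∀ c y → c ≢ y → (c ∷ y ∷ []) ∼ (0F ∷ 1F ∷ [])
  normalize₂ = from-yes (all? λ c → all? λ y →
    ¬? (c ≟ y) →-dec ((c ∷ y ∷ []) ∼? (0F ∷ 1F ∷ [])))

-- A permutation that carries `c` and `y` to 0 and 1 serves; it is applied to the whole word.
normalize : ∀ (xs : Vec Letter m) c y (ys : Vec Letter n) → c ≢ y →
            ∃ λ xs′ → ∃ λ ys′ → arch xs c (y ∷ ys) ∼ normalForm {m} {n} xs′ ys′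
normalize xs c y ys c≢y with π , eq ← normalize₂ c y c≢y =
  Vec.map (π ⟨$⟩ʳ_) xs , Vec.map (π ⟨$⟩ʳ_) ys , π ,
  trans (map-arch (π ⟨$⟩ʳ_) xs c (y ∷ ys))
    (cong₂ (λ d z → arch (Vec.map (π ⟨$⟩ʳ_) xs) d (z ∷ Vec.map (π ⟨$⟩ʳ_) ys))
      (∷-injectiveˡ eq) (∷-injectiveˡ (∷-injectiveʳ eq)))

-- The number of classes as a sum over normal forms.

∑-parsed : ℕ → ℕ → ℕ
∑-parsed m n = ∑ (words m) λ xs → ∑ (words n) λ ys → ⟦ parsedByBoth xs 0F (1F ∷ ys) ⟧

∣ParseWords∣-spines : ∀ m n → let n′ = ℕ.suc n in
  ∣ParseWords∣ (leftSpine n′ (rightSpine m leaf)) (rightSpine m (leftSpine n′ leaf)) ≡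
  ∑-parsed m n
∣ParseWords∣-spines m n = begin
  ∣ParseWords∣ t₁ t₂
    ≡⟨ HasSize-unique (proj₂ (ParseWords-finite t₁ t₂)) size ⟩
  length (withProofs both? normalForms)
    ≡⟨ length-withProofs both? normalForms ⟩
  (∑ normalForms λ w → ⟦ does (both? w) ⟧)
    ≡⟨ ∑-cartesianProductWith normalForm (words m) (words n) _ ⟩
  (∑ (words m) λ xs → ∑ (words n) λ ys → ⟦ does (both? (normalForm xs ys)) ⟧)
    ≡⟨ (∑-cong (words m) λ xs → ∑-cong (words n) λ ys → cong ⟦_⟧
         (does-⇔ (parsedByBoth-correct xs 0F (1F ∷ ys)) (both? _) (T? _))) ⟩
  ∑-parsed m n ∎
  where
  open ≡-Reasoning
  t₁ = leftSpine (ℕ.suc n) (rightSpine m leaf)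
  t₂ = rightSpine m (leftSpine (ℕ.suc n) leaf)

  both? : ∀ w → Dec (Parses t₁ w × Parses t₂ w)
  both? w = parses? t₁ w ×-dec parses? t₂ w

  normalForms : List Word
  normalForms = cartesianProductWith normalForm (words m) (words n)

  complete : IsEnumeration (ParseWords t₁ t₂) (withProofs both? normalForms)
  complete (w , p₁ , p₂)
    with b , δ ← Parses⇒Derives p₂
    with xs , c , y ∷ ys , refl , eq ← Derives-rightSpine-leftSpine⁻ m (ℕ.suc n) δ
    -- The second tree multiplies `c` by `y` before anything else. That product is therefore
    -- defined, so the two letters differ and the word can be normalized.
    with _ , eq′ , _ ← >>=-just (foldL c (y ∷ ys)) eq
    with d , c·y≡d , _ ← >>=-just (c · y) eq′
    with _ , _ , c≢y ← Rule⇒distinct (·⇒Rule c y c·y≡d)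
    with xs′ , ys′ , w∼ ← normalize xs c y ys c≢y =
    Any.map (λ where refl → w∼)
      (∈-withProofs both? (Parses-resp-∼ w∼ p₁ , Parses-resp-∼ w∼ p₂)
        (∈-cartesianProductWith⁺ normalForm (∈-words xs′) (∈-words ys′)))

  size : HasSize (ParseWords t₁ t₂) (length (withProofs both? normalForms))
  size = HasSize-length (ParseWords-decSetoid t₁ t₂)
    (AllPairs-withProofs both?
      (cartesianProductWith⁺ (setoid _) (setoid _) ∼-setoid
        normalForm normalForm-injective (words-! m) (words-! n)))
    complete

-- Of the `suc m` letters to the right of the centre, the first is the fixed 1 of the normal form,
-- which leaves `m` free ones.
a≡∑-parsed : ∀ m k → a (ℕ.suc m) (ℕ.suc k) ≡ ∑-parsed (ℕ.suc k) m
a≡∑-parsed m k = trans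
  (cong₂ ∣ParseWords∣ (LeftTurnTree-spine (ℕ.suc m) k) (RightTurnTree-spine (ℕ.suc k) m))
  (∣ParseWords∣-spines (ℕ.suc k) m)

-- The recurrence over the natural numbers, negative terms moved across.

SatisfiesRecurrence : (ℕ → ℕ) → Set
SatisfiesRecurrence f = ∀ n → f (3 ℕ.+ n) ℕ.+ 2 ℕ.* f n ≡ 2 ℕ.* f (2 ℕ.+ n) ℕ.+ f (1 ℕ.+ n)

recurrence-cong : ∀ {f} g → (∀ n → f n ≡ g n) → SatisfiesRecurrence f →
                  SatisfiesRecurrence g
recurrence-cong g f≗g rec n
  rewrite sym (f≗g n) | sym (f≗g (1 ℕ.+ n)) | sym (f≗g (2 ℕ.+ n)) | sym (f≗g (3 ℕ.+ n)) = rec n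

recurrence-+ : ∀ f g → SatisfiesRecurrence f → SatisfiesRecurrence g →
               SatisfiesRecurrence λ n → f n ℕ.+ g n
recurrence-+ f g rec-f rec-g n = begin
  (f 3+n ℕ.+ g 3+n) ℕ.+ 2 ℕ.* (f n ℕ.+ g n)
    ≡⟨ solve 4 (λ f₃ g₃ f₀ g₀ → (f₃ :+ g₃) :+ con 2 :* (f₀ :+ g₀) :=
         (f₃ :+ con 2 :* f₀) :+ (g₃ :+ con 2 :* g₀)) refl (f 3+n) (g 3+n) (f n) (g n) ⟩
  (f 3+n ℕ.+ 2 ℕ.* f n) ℕ.+ (g 3+n ℕ.+ 2 ℕ.* g n)
    ≡⟨ cong₂ ℕ._+_ (rec-f n) (rec-g n) ⟩
  (2 ℕ.* f 2+n ℕ.+ f 1+n) ℕ.+ (2 ℕ.* g 2+n ℕ.+ g 1+n)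
    ≡⟨ solve 4 (λ f₂ g₂ f₁ g₁ → (con 2 :* f₂ :+ f₁) :+ (con 2 :* g₂ :+ g₁) :=
         con 2 :* (f₂ :+ g₂) :+ (f₁ :+ g₁)) refl (f 2+n) (g 2+n) (f 1+n) (g 1+n) ⟩
  2 ℕ.* (f 2+n ℕ.+ g 2+n) ℕ.+ (f 1+n ℕ.+ g 1+n) ∎
  where
  open ≡-Reasoning
  open +-*-Solver
  1+n = 1 ℕ.+ n
  2+n = 2 ℕ.+ n
  3+n = 3 ℕ.+ n

recurrence-∑ : ∀ (xs : List A) (f : ℕ → A → ℕ) → (∀ x → SatisfiesRecurrence λ n → f n x) →
               SatisfiesRecurrence λ n → ∑ xs (f n)
recurrence-∑ []       f rec n = refl
recurrence-∑ (x ∷ xs) f rec = 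
  recurrence-+ (λ n → f n x) (λ n → ∑ xs (f n)) (rec x) (recurrence-∑ xs f rec)

-- Walks of pairs of labels and their recurrence.

module _ (h : Letter → Maybe Letter) where

  -- `p` and `q` are the labels reached so far in the two trees, with `nothing` for a failed fold.
  -- `h` stands for what the second tree does after reading all of `ys`, namely fold in the
  -- left-hand letters; the argument is uniform in it.
  walks : Maybe Letter → Maybe Letter → ℕ → ℕ
  walks p q n = ∑ (words n) λ ys →
    ⟦ is-just (p >>= λ c → foldL c ys) ∧ is-just ((q >>= λ c → foldL c ys) >>= h) ⟧

  walks-nothingˡ : ∀ q n → walks nothing q n ≡ 0
  walks-nothingˡ q n = ∑-zero (words n) λ _ → refl

  walks-nothingʳ : ∀ p n → walks p nothing n ≡ 0
  walks-nothingʳ p n = ∑-zero (words n) λ ys →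
    cong ⟦_⟧ (∧-zeroʳ (is-just (p >>= λ c → foldL c ys)))

  walks-suc : ∀ c d n → walks (just c) (just d) (ℕ.suc n) ≡
                        ∑ (allFin 3) λ y → walks (c · y) (d · y) n
  walks-suc c d n = ∑-cartesianProductWith _∷_ (allFin 3) (words n) _

  -- Reading `c` or `d` makes one of the two products undefined. The third letter `e` gives
  -- `c · e = d` and `d · e = c`.
  walks-swap : ∀ c d → c ≢ d → ∀ n →
               walks (just c) (just d) (ℕ.suc n) ≡ walks (just d) (just c) n
  walks-swap 0F 0F c≢d n = ⊥-elim (c≢d refl)
  walks-swap 0F 1F c≢d n
    rewrite walks-suc 0F 1F n | walks-nothingˡ (just 2F) n | walks-nothingʳ (just 2F) n =
    +-identityʳ _
  walks-swap 0F 2F c≢d n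
    rewrite walks-suc 0F 2F n | walks-nothingˡ (just 1F) n | walks-nothingʳ (just 1F) n =
    +-identityʳ _
  walks-swap 1F 0F c≢d n
    rewrite walks-suc 1F 0F n | walks-nothingˡ (just 2F) n | walks-nothingʳ (just 2F) n =
    +-identityʳ _
  walks-swap 1F 1F c≢d n = ⊥-elim (c≢d refl)
  walks-swap 1F 2F c≢d n
    rewrite walks-suc 1F 2F n | walks-nothingˡ (just 0F) n | walks-nothingʳ (just 0F) n =
    +-identityʳ _
  walks-swap 2F 0F c≢d n
    rewrite walks-suc 2F 0F n | walks-nothingˡ (just 1F) n | walks-nothingʳ (just 1F) n =
    +-identityʳ _
  walks-swap 2F 1F c≢d n
    rewrite walks-suc 2F 1F n | walks-nothingˡ (just 0F) n | walks-nothingʳ (just 0F) n =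
    +-identityʳ _
  walks-swap 2F 2F c≢d n = ⊥-elim (c≢d refl)

  diagonal : Letter → ℕ → ℕ
  diagonal c = walks (just c) (just c)

  total : ℕ → ℕ
  total n = ∑ (allFin 3) λ c → diagonal c n

  -- Reading `c` fails in both trees, and the other two letters lead to the other two pairs of equal
  -- labels. Adding `diagonal c n` supplies the missing third term.
  diagonal-suc : ∀ c n → diagonal c (ℕ.suc n) ℕ.+ diagonal c n ≡ total n
  diagonal-suc 0F n rewrite walks-suc 0F 0F n | walks-nothingˡ nothing n =
    solve 3 (λ x y z → (z :+ (y :+ con 0)) :+ x := x :+ (y :+ (z :+ con 0)))
      refl (diagonal 0F n) (diagonal 1F n) (diagonal 2F n)
    where open +-*-Solver
  diagonal-suc 1F n rewrite walks-suc 1F 1F n | walks-nothingˡ nothing n =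
    solve 3 (λ x y z → (z :+ (x :+ con 0)) :+ y := x :+ (y :+ (z :+ con 0)))
      refl (diagonal 0F n) (diagonal 1F n) (diagonal 2F n)
    where open +-*-Solver
  diagonal-suc 2F n rewrite walks-suc 2F 2F n | walks-nothingˡ nothing n =
    solve 3 (λ x y z → (y :+ (x :+ con 0)) :+ z := x :+ (y :+ (z :+ con 0)))
      refl (diagonal 0F n) (diagonal 1F n) (diagonal 2F n)
    where open +-*-Solver

  -- Summing `diagonal-suc` over the three letters gives `total (suc n) + total n = 3 * total n`;
  -- cancel one `total n`.
  total-suc : ∀ n → total (ℕ.suc n) ≡ 2 ℕ.* total n
  total-suc n = +-cancelˡ-≡ (total n) _ _ (begin
    total n ℕ.+ total (ℕ.suc n)
      ≡⟨ solve 6 (λ x y z x′ y′ z′ →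
           (x :+ (y :+ (z :+ con 0))) :+ (x′ :+ (y′ :+ (z′ :+ con 0))) :=
           (x′ :+ x) :+ ((y′ :+ y) :+ (z′ :+ z))) refl
           (diagonal 0F n) (diagonal 1F n) (diagonal 2F n)
           (diagonal 0F (ℕ.suc n)) (diagonal 1F (ℕ.suc n)) (diagonal 2F (ℕ.suc n)) ⟩
    _ ≡⟨ cong₂ ℕ._+_ (diagonal-suc 0F n)
           (cong₂ ℕ._+_ (diagonal-suc 1F n) (diagonal-suc 2F n)) ⟩
    total n ℕ.+ (total n ℕ.+ total n)
      ≡⟨ cong (λ s → total n ℕ.+ (total n ℕ.+ s)) (sym (+-identityʳ (total n))) ⟩
    total n ℕ.+ 2 ℕ.* total n ∎)
    where
    open ≡-Reasoning
    open +-*-Solver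

  diagonal-recurrence : ∀ c → SatisfiesRecurrence (diagonal c)
  -- Adding `g₂ + 2 * g₁` to both sides groups the terms into sums of consecutive values, each of
  -- which is a `total`. What remains is that `total (2 + n) + 2 * total n` is three times
  -- `total (1 + n)`, which follows from doubling.
  diagonal-recurrence c n = +-cancelˡ-≡ (g₂ ℕ.+ 2 ℕ.* g₁) _ _ (begin
    (g₂ ℕ.+ 2 ℕ.* g₁) ℕ.+ (g₃ ℕ.+ 2 ℕ.* g₀)
      ≡⟨ solve 4 (λ g₀ g₁ g₂ g₃ → (g₂ :+ con 2 :* g₁) :+ (g₃ :+ con 2 :* g₀) :=
           (g₃ :+ g₂) :+ con 2 :* (g₁ :+ g₀)) refl g₀ g₁ g₂ g₃ ⟩
    (g₃ ℕ.+ g₂) ℕ.+ 2 ℕ.* (g₁ ℕ.+ g₀)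
      ≡⟨ cong₂ (λ s t → s ℕ.+ 2 ℕ.* t) (diagonal-suc c (2 ℕ.+ n)) (diagonal-suc c n) ⟩
    total (2 ℕ.+ n) ℕ.+ 2 ℕ.* total n
      ≡⟨ cong₂ ℕ._+_ (total-suc (1 ℕ.+ n)) (sym (total-suc n)) ⟩
    2 ℕ.* total (1 ℕ.+ n) ℕ.+ total (1 ℕ.+ n)
      ≡⟨ cong (λ t → 2 ℕ.* t ℕ.+ t) (sym (diagonal-suc c (1 ℕ.+ n))) ⟩
    2 ℕ.* (g₂ ℕ.+ g₁) ℕ.+ (g₂ ℕ.+ g₁)
      ≡⟨ solve 2 (λ g₁ g₂ → con 2 :* (g₂ :+ g₁) :+ (g₂ :+ g₁) :=
           (g₂ :+ con 2 :* g₁) :+ (con 2 :* g₂ :+ g₁)) refl g₁ g₂ ⟩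
    (g₂ ℕ.+ 2 ℕ.* g₁) ℕ.+ (2 ℕ.* g₂ ℕ.+ g₁) ∎)
    where
    open ≡-Reasoning
    open +-*-Solver
    g₀ = diagonal c n
    g₁ = diagonal c (1 ℕ.+ n)
    g₂ = diagonal c (2 ℕ.+ n)
    g₃ = diagonal c (3 ℕ.+ n)

  -- A failed fold gives the zero sequence. Unequal labels give period two, since two swaps restore
  -- the pair; this accounts for the factor `(E - 1)(E + 1)`. Equal labels are the diagonal case.
  walks-recurrence : ∀ p q → SatisfiesRecurrence (walks p q)
  walks-recurrence nothing  q       =
    recurrence-cong _ (sym ∘ walks-nothingˡ q) λ _ → refl
  walks-recurrence (just c) nothing =
    recurrence-cong _ (sym ∘ walks-nothingʳ (just c)) λ _ → refl
  walks-recurrence (just c) (just d) n with c ≟ d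
  ... | yes refl = diagonal-recurrence c n
  ... | no  c≢d  = begin
    g (3 ℕ.+ n) ℕ.+ 2 ℕ.* g n
      ≡⟨ cong₂ (λ s t → s ℕ.+ 2 ℕ.* t) (period (1 ℕ.+ n)) (sym (period n)) ⟩
    g (1 ℕ.+ n) ℕ.+ 2 ℕ.* g (2 ℕ.+ n)    ≡⟨ +-comm (g (1 ℕ.+ n)) _ ⟩
    2 ℕ.* g (2 ℕ.+ n) ℕ.+ g (1 ℕ.+ n)    ∎
    where
    open ≡-Reasoning
    g = walks (just c) (just d)
    period : ∀ n → g (2 ℕ.+ n) ≡ g n
    period n = trans (walks-swap c d c≢d (ℕ.suc n)) (walks-swap d c (c≢d ∘ sym) n)

-- The first letter 1 is read in both trees: from foldR xs 0 in the first one,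
-- and from 0, which gives 2, in the second one.
∑-parsed≡walks : ∀ (xs : Vec Letter m) n →
  walks (foldR xs) (foldR xs 0F >>= (_· 1F)) (just 2F) n ≡
  ∑ (words n) λ ys → ⟦ parsedByBoth xs 0F (1F ∷ ys) ⟧
∑-parsed≡walks xs n with foldR xs 0F
... | nothing = refl
... | just _  = refl

-- For each fixed `xs` the count over `ys` is a number of walks, and the recurrence, being linear,
-- passes to the sum over `xs`.
∑-parsed-recurrence : ∀ k → SatisfiesRecurrence (∑-parsed k)
∑-parsed-recurrence k = recurrence-∑ (words k) count λ xs →
  recurrence-cong (λ n → count n xs) (∑-parsed≡walks xs)
    (walks-recurrence (foldR xs) (foldR xs 0F >>= (_· 1F)) (just 2F))
  where
  count : ℕ → Vec Letter k → ℕ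
  count n xs = ∑ (words n) λ ys → ⟦ parsedByBoth xs 0F (1F ∷ ys) ⟧

-- Passage to the integers.

fromℕ-recurrence : ∀ x₃ x₂ x₁ x₀ → x₃ ℕ.+ 2 ℕ.* x₀ ≡ 2 ℕ.* x₂ ℕ.+ x₁ →
                   + x₃ - + 2 * + x₂ - + x₁ + + 2 * + x₀ ≡ 0ℤ
fromℕ-recurrence x₃ x₂ x₁ x₀ eq = begin
  + x₃ - + 2 * + x₂ - + x₁ + + 2 * + x₀
    ≡⟨ solve 4 (λ x₃ x₂ x₁ x₀ → x₃ :- con (+ 2) :* x₂ :- x₁ :+ con (+ 2) :* x₀ :=
         (x₃ :+ con (+ 2) :* x₀) :- (con (+ 2) :* x₂ :+ x₁)) refl (+ x₃) (+ x₂) (+ x₁) (+ x₀) ⟩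
  (+ x₃ + + 2 * + x₀) - (+ 2 * + x₂ + + x₁)
    -- Sums of nonnegative integers compute to `+_` of a sum, so only the products need rewriting.
    ≡⟨ cong₂ (λ y z → (+ x₃ + y) - (z + + x₁)) (sym (pos-* 2 x₀)) (sym (pos-* 2 x₂)) ⟩
  + (x₃ ℕ.+ 2 ℕ.* x₀) - + (2 ℕ.* x₂ ℕ.+ x₁)
    ≡⟨ i≡j⇒i-j≡0 (cong +_ eq) ⟩
  0ℤ ∎
  where
  open ≡-Reasoning
  open ℤ.+-*-Solver

theorem17 : (m k : ℕ) → m ≥ 1 → k ≥ 1 →
    + a (m ℕ.+ 3) k - + 2 * + a (m ℕ.+ 2) k - + a (m ℕ.+ 1) k + + 2 * + a m k ≡ 0ℤ
theorem17 (ℕ.suc m) (ℕ.suc k) _ _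
  -- `suc m + 3` reduces to `suc (m + 3)`, the shape that `a≡∑-parsed` expects; commutativity then
  -- exposes the shifts `3 + m`, `2 + m` and `1 + m`.
  rewrite a≡∑-parsed (m ℕ.+ 3) k | a≡∑-parsed (m ℕ.+ 2) k
        | a≡∑-parsed (m ℕ.+ 1) k | a≡∑-parsed m k
        | +-comm m 3 | +-comm m 2 | +-comm m 1 =
  fromℕ-recurrence (f (3 ℕ.+ m)) (f (2 ℕ.+ m)) (f (1 ℕ.+ m)) (f m)
    (∑-parsed-recurrence (ℕ.suc k) m)
  where
  f = ∑-parsed (ℕ.suc k)
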